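{- Let $\mathcal{D}$ be a Ryser design of Type-2 of order $v$ and index $\lambda$. Let $A$ be a non average block of $\mathcal{D}$, and let $\overline{\mathcal{D}}=\mathcal{D}*A$ be the new Ryser design of order $v$ and index $\overline{\lambda}=|A|-\lambda$ obtained from $\mathcal{D}$ by block complementation with respect to $A$. If $A$ is a large (respectively small) block in $\mathcal{D}$, then $A$ is a small (respectively large) block in $\overline{\mathcal{D}}$. Let $B$ be any other block of $\mathcal{D}$ and let $\overline{B}=A\triangle B$ be the new block of $\overline{\mathcal{D}}$ obtained from $B$. Then: (i) If $|B|>|A|$ (respectively $|B|<|A|$), then $\overline{B}$ is a large (respectively small) block in $\overline{\mathcal{D}}$. (ii) If $|B|=2\lambda$, then $|\overline{B}|=|A|$. (iii) If $|B|=|A|$, then $|\overline{B}|=2\overline{\lambda}$.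
   Context: A design is a pair $(X,L)$ with $X$ a finite set (points) and $L$ a set of subsets of $X$ (blocks). A symmetric $(v,k,\lambda)$ design is a design $(X,L)$ with $|X|=|L|=v$, $|B_1\cap B_2|=\lambda\geq 1$ for all distinct blocks $B_1,B_2$, and $|B|=k>\lambda$ for every block $B$. A Ryser design of order $v$ and index $\lambda$ is a design $(X,L)$ with $|X|=|L|=v$, $|B_1\cap B_2|=\lambda$ for all distinct blocks $B_1,B_2$, $|B|>\lambda$ for every block $B$, and such that there exist blocks $B_1,B_2$ with $|B_1|\neq|B_2|$. In a Ryser design of index $\lambda$, a block $A$ is large, average or small if $|A|>2\lambda$, $|A|=2\lambda$ or $|A|<2\lambda$ respectively; a block that is not average is called non average. In $\overline{\mathcal{D}}$ these notions refer to its own index $\overline{\lambda}$. For a design $\mathcal{D}=(X,\mathcal{A})$ and a block $A\in\mathcal{A}$, the block complementation of $\mathcal{D}$ with respect to $A$ is $\mathcal{D}*A=(X,\mathcal{B})$ with $\mathcal{B}=\{A\}\cup\{A\triangle B: B\in\mathcal{A}, B\neq A\}$, where $\triangle$ is symmetric difference. If $\mathcal{D}$ is a symmetric $(v,k,k-\lambda)$ design with $k\neq 2\lambda$ and $A$ is a block of $\mathcal{D}$, then $\mathcal{D}*A$ is a Ryser design of order $v$ and index $\lambda$; a Ryser design obtained in this way from some symmetric design is said to be of Type-1. A Ryser design is of Type-2 if it is not of Type-1. -}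

module Defs where

open import Data.Fin.Subset using (Subset; _∩_; _∪_; _─_; ∣_∣)
open import Data.List using (List; length)
import Data.List.Membership.Propositional as List
open import Data.List.Relation.Unary.Unique.Propositional using (Unique)
open import Data.Nat using (ℕ; _*_; _∸_; _≤_; _<_; _>_)
open import Data.Product using (_×_; ∃-syntax)
open import Data.Sum using (_⊎_)
open import Function.Bundles using (_⇔_)
open import Level using (0ℓ)
open import Relation.Binary.PropositionalEquality using (_≡_; _≢_)
open import Relation.Nullary using (¬_)
open import Relation.Unary using (Pred; _∈_; _≐_)

infixl 6 _△_
infixl 7 _⋆_

_△_ : ∀ {v} → Subset v → Subset v → Subset v
A △ B = (A ─ B) ∪ (B ─ A)

-- A design on the v-element point set Fin v is given by its set of blocks.
-- Two designs with the same blocks are identified through _≐_.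
Design : ℕ → Set₁
Design v = Pred (Subset v) 0ℓ

-- |L| = m: the elements of L can be listed without repetition in a list of
-- length m.  (Membership proofs need not be unique, so a bijection between
-- Fin m and the Σ-type of members of L would not express this.)
HasCardinality : ∀ {v} → Design v → ℕ → Set
HasCardinality {v} L m =
  ∃[ Bs ] Unique Bs × length Bs ≡ m × (∀ (B : Subset v) → B List.∈ Bs ⇔ B ∈ L)

-- The parameter λ is written l, since λ is reserved.

record IsSymmetric {v : ℕ} (k l : ℕ) (𝓓 : Design v) : Set where
  field
    cardinality  : HasCardinality 𝓓 v
    intersection : ∀ {B₁ B₂} → B₁ ∈ 𝓓 → B₂ ∈ 𝓓 → B₁ ≢ B₂ → ∣ B₁ ∩ B₂ ∣ ≡ l
    l≥1          : 1 ≤ l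
    blockSize    : ∀ {B} → B ∈ 𝓓 → ∣ B ∣ ≡ k
    k>l          : k > l

record IsRyser {v : ℕ} (l : ℕ) (𝓓 : Design v) : Set where
  field
    cardinality   : HasCardinality 𝓓 v
    intersection  : ∀ {B₁ B₂} → B₁ ∈ 𝓓 → B₂ ∈ 𝓓 → B₁ ≢ B₂ → ∣ B₁ ∩ B₂ ∣ ≡ l
    blockSize>l   : ∀ {B} → B ∈ 𝓓 → ∣ B ∣ > l
    distinctSizes : ∃[ B₁ ] ∃[ B₂ ] B₁ ∈ 𝓓 × B₂ ∈ 𝓓 × ∣ B₁ ∣ ≢ ∣ B₂ ∣

_⋆_ : ∀ {v} → Design v → Subset v → Design v
(𝓓 ⋆ A) C = C ≡ A ⊎ (∃[ B ] B ∈ 𝓓 × B ≢ A × C ≡ A △ B)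

-- The truncated subtraction is harmless: IsSymmetric k (k ∸ l) 𝓔 forces
-- 1 ≤ k ∸ l, hence l < k.
Type-1 : ∀ {v} → Design v → Set₁
Type-1 {v} 𝓓 =
  ∃[ k ] ∃[ l ] ∃[ 𝓔 ] ∃[ A ]
    IsSymmetric {v} k (k ∸ l) 𝓔 × k ≢ 2 * l × A ∈ 𝓔 × 𝓓 ≐ 𝓔 ⋆ A

Type-2 : ∀ {v} → Design v → Set₁
Type-2 𝓓 = ¬ Type-1 𝓓

-- Size of a block relative to the index l of the Ryser design containing it.
Large Average Small : ∀ {v} → ℕ → Subset v → Set
Large   l A = ∣ A ∣ > 2 * l
Average l A = ∣ A ∣ ≡ 2 * l
Small   l A = ∣ A ∣ < 2 * l

{-# OPTIONS --safe #-}

-- Block complementation with respect to A is an involution, and counting points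
-- with A △ B in place of B gives |A △ B| = (|A| - λ) + (|B| - λ) and the common
-- intersection size |A| - λ.  If all blocks of 𝓓 ⋆ A had the same size, 𝓓 ⋆ A
-- would be a symmetric design and 𝓓 = (𝓓 ⋆ A) ⋆ A would be of Type-1.  The index λ
-- cannot be 0: v disjoint nonempty blocks on v points are all singletons.

module Submission where

open import Defs
open import Data.Bool.Properties using () renaming (_≟_ to _≟ᵇ_)
open import Data.Fin.Subset
  using (Subset; inside; outside; ⊥; _∩_; _∪_; ⋃; ∣_∣)
open import Data.Fin.Subset.Properties
  using (∣p∣≤n; ∣⊥∣≡0; ∩-comm; ∩-idem; ∩-zeroʳ; ∩-distribˡ-∪)
open import Data.List using (List; []; _∷_; _++_; length; map)
open import Data.List.Membership.Propositional using (find) renaming (_∈_ to _∈ₗ_)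
open import Data.List.Membership.Propositional.Properties using (∈-∃++; ∈-map⁺; ∈-map⁻)
open import Data.List.Properties using (length-map)
open import Data.List.Relation.Binary.Permutation.Propositional
  using (_↭_; ↭-sym; ↭⇒↭ₛ)
open import Data.List.Relation.Binary.Permutation.Propositional.Properties
  using (shift; ∈-resp-↭; ↭-length)
open import Data.List.Relation.Binary.Permutation.Setoid.Properties using (Unique-resp-↭)
open import Data.List.Relation.Unary.All as All using (All; []; _∷_)
open import Data.List.Relation.Unary.All.Properties as All using ()
open import Data.List.Relation.Unary.AllPairs using (AllPairs; []; _∷_)
open import Data.List.Relation.Unary.Any using (here; there)
open import Data.List.Relation.Unary.Unique.Propositional using (Unique)
open import Data.List.Relation.Unary.Unique.Propositional.Properties as Unique using ()
open import Data.Nat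
  using (ℕ; suc; _+_; _*_; _∸_; _≤_; _<_; _>_; z≤n; s≤s; _≟_)
open import Data.Nat.ListAction using (sum)
open import Data.Nat.Properties
open import Data.Nat.Tactic.RingSolver using (solve-∀)
open import Data.Product using (_×_; _,_; ∃-syntax)
open import Data.Sum using (inj₁; inj₂)
open import Data.Vec.Base using ([]; _∷_)
open import Data.Vec.Properties using (≡-dec)
open import Function using (_∘_)
open import Function.Bundles using (Equivalence; mk⇔)
open import Relation.Binary using (Rel; DecidableEquality)
open import Relation.Binary.PropositionalEquality
  using (_≡_; _≢_; refl; sym; trans; cong; cong₂; subst; setoid; ≢-sym; module ≡-Reasoning)
open import Relation.Nullary using (¬_; yes; no; contradiction; ¬?)
open import Relation.Nullary.Decidable using (decidable-stable)
open import Relation.Unary using (_∈_; _∉_; _≐_)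

infix 4 _≟ˢ_

_≟ˢ_ : ∀ {v} → DecidableEquality (Subset v)
_≟ˢ_ = ≡-dec _≟ᵇ_

-- Algebra of the symmetric difference.

△-identityʳ : ∀ {v} (A : Subset v) → A △ ⊥ ≡ A
△-identityʳ []            = refl
△-identityʳ (outside ∷ A) = cong (outside ∷_) (△-identityʳ A)
△-identityʳ (inside  ∷ A) = cong (inside ∷_) (△-identityʳ A)

△-involutive : ∀ {v} (A B : Subset v) → A △ (A △ B) ≡ B
△-involutive []            []            = refl
△-involutive (outside ∷ A) (outside ∷ B) = cong (outside ∷_) (△-involutive A B)
△-involutive (outside ∷ A) (inside  ∷ B) = cong (inside ∷_) (△-involutive A B)
△-involutive (inside  ∷ A) (outside ∷ B) = cong (outside ∷_) (△-involutive A B)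
△-involutive (inside  ∷ A) (inside  ∷ B) = cong (inside ∷_) (△-involutive A B)

△-injectiveʳ : ∀ {v} (A : Subset v) {B C} → A △ B ≡ A △ C → B ≡ C
△-injectiveʳ A {B} {C} eq =
  trans (sym (△-involutive A B)) (trans (cong (A △_) eq) (△-involutive A C))

-- This rules out a collision in `𝓓 ⋆ A`: a new block can coincide with the retained block `A` only
-- if it comes from an empty block.
A△B≡A⇒B≡⊥ : ∀ {v} (A B : Subset v) → A △ B ≡ A → B ≡ ⊥
A△B≡A⇒B≡⊥ A B eq = △-injectiveʳ A (trans eq (sym (△-identityʳ A)))

-- Sizes of unions and symmetric differences.

∣p∪q∣+∣p∩q∣≡∣p∣+∣q∣ : ∀ {v} (p q : Subset v) →
  ∣ p ∪ q ∣ + ∣ p ∩ q ∣ ≡ ∣ p ∣ + ∣ q ∣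
∣p∪q∣+∣p∩q∣≡∣p∣+∣q∣ []            []            = refl
∣p∪q∣+∣p∩q∣≡∣p∣+∣q∣ (outside ∷ p) (outside ∷ q) = ∣p∪q∣+∣p∩q∣≡∣p∣+∣q∣ p q
∣p∪q∣+∣p∩q∣≡∣p∣+∣q∣ (outside ∷ p) (inside  ∷ q)
  rewrite +-suc ∣ p ∣ ∣ q ∣ = cong suc (∣p∪q∣+∣p∩q∣≡∣p∣+∣q∣ p q)
∣p∪q∣+∣p∩q∣≡∣p∣+∣q∣ (inside  ∷ p) (outside ∷ q) = cong suc (∣p∪q∣+∣p∩q∣≡∣p∣+∣q∣ p q)
∣p∪q∣+∣p∩q∣≡∣p∣+∣q∣ (inside  ∷ p) (inside  ∷ q)
  rewrite +-suc ∣ p ∪ q ∣ ∣ p ∩ q ∣ | +-suc ∣ p ∣ ∣ q ∣ =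
  cong (suc ∘ suc) (∣p∪q∣+∣p∩q∣≡∣p∣+∣q∣ p q)

m+[n+1+o]≡1+[m+[n+o]] : ∀ m n o → m + (n + suc o) ≡ suc (m + (n + o))
m+[n+1+o]≡1+[m+[n+o]] m n o = trans (cong (m +_) (+-suc n o)) (+-suc m (n + o))

-- Holds point by point: outside `A` a point contributes bc to both sides, and inside `A` it
-- contributes (1 - b)(1 - c) + b + c = 1 + bc, where b and c indicate membership in `B` and `C`.
-- The choices `C = B` and `B = ⊥` give the next two size formulas, and the additive form avoids
-- truncated subtraction.
∣△∩△∣ : ∀ {v} (A B C : Subset v) →
  ∣ (A △ B) ∩ (A △ C) ∣ + (∣ A ∩ B ∣ + ∣ A ∩ C ∣) ≡ ∣ A ∣ + ∣ B ∩ C ∣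
∣△∩△∣ []            []            []            = refl
∣△∩△∣ (outside ∷ A) (outside ∷ B) (outside ∷ C) = ∣△∩△∣ A B C
∣△∩△∣ (outside ∷ A) (outside ∷ B) (inside  ∷ C) = ∣△∩△∣ A B C
∣△∩△∣ (outside ∷ A) (inside  ∷ B) (outside ∷ C) = ∣△∩△∣ A B C
∣△∩△∣ (outside ∷ A) (inside  ∷ B) (inside  ∷ C) =
  trans (cong suc (∣△∩△∣ A B C)) (sym (+-suc ∣ A ∣ ∣ B ∩ C ∣))
∣△∩△∣ (inside  ∷ A) (outside ∷ B) (outside ∷ C) = cong suc (∣△∩△∣ A B C)
∣△∩△∣ (inside  ∷ A) (outside ∷ B) (inside  ∷ C) =
  trans (m+[n+1+o]≡1+[m+[n+o]] (∣ (A △ B) ∩ (A △ C) ∣) ∣ A ∩ B ∣ ∣ A ∩ C ∣) (cong suc (∣△∩△∣ A B C))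
∣△∩△∣ (inside  ∷ A) (inside  ∷ B) (outside ∷ C) =
  trans (+-suc (∣ (A △ B) ∩ (A △ C) ∣) (∣ A ∩ B ∣ + ∣ A ∩ C ∣)) (cong suc (∣△∩△∣ A B C))
∣△∩△∣ (inside  ∷ A) (inside  ∷ B) (inside  ∷ C) =
  trans (m+[n+1+o]≡1+[m+[n+o]] (∣ (A △ B) ∩ (A △ C) ∣) (suc ∣ A ∩ B ∣) ∣ A ∩ C ∣) (cong suc (
  trans (+-suc (∣ (A △ B) ∩ (A △ C) ∣) (∣ A ∩ B ∣ + ∣ A ∩ C ∣)) (
  trans (cong suc (∣△∩△∣ A B C)) (sym (+-suc ∣ A ∣ ∣ B ∩ C ∣)))))

∣△∣ : ∀ {v} (A B : Subset v) → ∣ A △ B ∣ + (∣ A ∩ B ∣ + ∣ A ∩ B ∣) ≡ ∣ A ∣ + ∣ B ∣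
∣△∣ A B = begin
  ∣ A △ B ∣ + (∣ A ∩ B ∣ + ∣ A ∩ B ∣)
    ≡⟨ cong (λ C → ∣ C ∣ + (∣ A ∩ B ∣ + ∣ A ∩ B ∣)) (∩-idem (A △ B)) ⟨
  ∣ (A △ B) ∩ (A △ B) ∣ + (∣ A ∩ B ∣ + ∣ A ∩ B ∣)
    ≡⟨ ∣△∩△∣ A B B ⟩
  ∣ A ∣ + ∣ B ∩ B ∣
    ≡⟨ cong (λ C → ∣ A ∣ + ∣ C ∣) (∩-idem B) ⟩
  ∣ A ∣ + ∣ B ∣ ∎
  where open ≡-Reasoning

∣A∩[A△B]∣+∣A∩B∣≡∣A∣ : ∀ {v} (A B : Subset v) → ∣ A ∩ (A △ B) ∣ + ∣ A ∩ B ∣ ≡ ∣ A ∣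
∣A∩[A△B]∣+∣A∩B∣≡∣A∣ {v} A B = begin
  ∣ A ∩ (A △ B) ∣ + ∣ A ∩ B ∣
    ≡⟨ cong₂ _+_ (cong (λ C → ∣ C ∩ (A △ B) ∣) (△-identityʳ A))
                 (cong (_+ ∣ A ∩ B ∣) (∣p∩⊥∣≡0 A)) ⟨
  ∣ (A △ ⊥) ∩ (A △ B) ∣ + (∣ A ∩ ⊥ ∣ + ∣ A ∩ B ∣)
    ≡⟨ ∣△∩△∣ A ⊥ B ⟩
  ∣ A ∣ + ∣ ⊥ ∩ B ∣
    ≡⟨ cong (∣ A ∣ +_) (trans (cong ∣_∣ (∩-comm ⊥ B)) (∣p∩⊥∣≡0 B)) ⟩
  ∣ A ∣ + 0
    ≡⟨ +-identityʳ ∣ A ∣ ⟩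
  ∣ A ∣ ∎
  where
  open ≡-Reasoning
  ∣p∩⊥∣≡0 : ∀ (p : Subset v) → ∣ p ∩ ⊥ ∣ ≡ 0
  ∣p∩⊥∣≡0 p = trans (cong ∣_∣ (∩-zeroʳ p)) (∣⊥∣≡0 v)

-- Disjoint families of subsets.

∣p∩⋃∣≡0 : ∀ {v} (p : Subset v) {qs} → All (λ q → ∣ p ∩ q ∣ ≡ 0) qs → ∣ p ∩ ⋃ qs ∣ ≡ 0
∣p∩⋃∣≡0 {v} p [] = trans (cong ∣_∣ (∩-zeroʳ p)) (∣⊥∣≡0 v)
-- The size of the overlap is added so that inclusion-exclusion applies; the total is 0, hence so is
-- the first summand.
∣p∩⋃∣≡0 p {q ∷ qs} (∣p∩q∣≡0 ∷ eqs) = m+n≡0⇒m≡0 ∣ p ∩ (q ∪ ⋃ qs) ∣ (begin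
  ∣ p ∩ (q ∪ ⋃ qs) ∣ + ∣ (p ∩ q) ∩ (p ∩ ⋃ qs) ∣
    ≡⟨ cong (λ r → ∣ r ∣ + ∣ (p ∩ q) ∩ (p ∩ ⋃ qs) ∣) (∩-distribˡ-∪ p q (⋃ qs)) ⟩
  ∣ (p ∩ q) ∪ (p ∩ ⋃ qs) ∣ + ∣ (p ∩ q) ∩ (p ∩ ⋃ qs) ∣
    ≡⟨ ∣p∪q∣+∣p∩q∣≡∣p∣+∣q∣ (p ∩ q) (p ∩ ⋃ qs) ⟩
  ∣ p ∩ q ∣ + ∣ p ∩ ⋃ qs ∣
    ≡⟨ cong₂ _+_ ∣p∩q∣≡0 (∣p∩⋃∣≡0 p eqs) ⟩
  0 ∎)
  where open ≡-Reasoning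

∣⋃∣-disjoint : ∀ {v} {ps : List (Subset v)} →
  AllPairs (λ p q → ∣ p ∩ q ∣ ≡ 0) ps → ∣ ⋃ ps ∣ ≡ sum (map ∣_∣ ps)
∣⋃∣-disjoint {v} [] = ∣⊥∣≡0 v
∣⋃∣-disjoint {ps = p ∷ ps} (p∩ps ∷ ps-disjoint) = begin
  ∣ p ∪ ⋃ ps ∣                   ≡⟨ +-identityʳ _ ⟨
  ∣ p ∪ ⋃ ps ∣ + 0               ≡⟨ cong (∣ p ∪ ⋃ ps ∣ +_) (∣p∩⋃∣≡0 p p∩ps) ⟨
  ∣ p ∪ ⋃ ps ∣ + ∣ p ∩ ⋃ ps ∣    ≡⟨ ∣p∪q∣+∣p∩q∣≡∣p∣+∣q∣ p (⋃ ps) ⟩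
  ∣ p ∣ + ∣ ⋃ ps ∣               ≡⟨ cong (∣ p ∣ +_) (∣⋃∣-disjoint ps-disjoint) ⟩
  ∣ p ∣ + sum (map ∣_∣ ps)       ∎
  where open ≡-Reasoning

-- Membership is passed to the implication because distinct subsets have a prescribed intersection
-- size only when both are blocks.
AllPairs-map-∈ : ∀ {a r s} {X : Set a} {R : Rel X r} {S : Rel X s} {xs : List X} →
  (∀ {x y} → x ∈ₗ xs → y ∈ₗ xs → R x y → S x y) → AllPairs R xs → AllPairs S xs
AllPairs-map-∈ f []         = []
AllPairs-map-∈ f (Rx ∷ Rxs) =
  All.tabulate (λ y∈ → f (here refl) (there y∈) (All.lookup Rx y∈)) ∷
  AllPairs-map-∈ (λ x∈ y∈ → f (there x∈) (there y∈)) Rxs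

length≤sum : ∀ {ns} → All (1 ≤_) ns → length ns ≤ sum ns
length≤sum []           = z≤n
length≤sum (1≤n ∷ 1≤ns) = +-mono-≤ 1≤n (length≤sum 1≤ns)

-- The tail already sums to at least its length, which leaves at most 1 for the head; the head takes
-- at least 1, so the tail inherits the bound.
sum≤length⇒All≡1 : ∀ {ns} → All (1 ≤_) ns → sum ns ≤ length ns → All (_≡ 1) ns
sum≤length⇒All≡1 [] _ = []
sum≤length⇒All≡1 {n ∷ ns} (1≤n ∷ 1≤ns) sum≤ =
  ≤-antisym (+-cancelʳ-≤ (length ns) n 1 (≤-trans (+-monoʳ-≤ n (length≤sum 1≤ns)) sum≤)) 1≤n ∷
  sum≤length⇒All≡1 1≤ns
    (+-cancelˡ-≤ 1 (sum ns) (length ns) (≤-trans (+-monoˡ-≤ (sum ns) 1≤n) sum≤))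

-- By disjointness the sizes add up to the size of the union, which is at most `v`, the number of
-- sets; there is no room for a size above 1.
disjoint-nonempty⇒All-singleton : ∀ {v} {ps : List (Subset v)} → length ps ≡ v →
  All (λ p → 1 ≤ ∣ p ∣) ps → AllPairs (λ p q → ∣ p ∩ q ∣ ≡ 0) ps → All (λ p → ∣ p ∣ ≡ 1) ps
disjoint-nonempty⇒All-singleton {v} {ps} len≡v nonempty disjoint =
  All.map⁻ (sum≤length⇒All≡1 (All.map⁺ nonempty) (begin
    sum (map ∣_∣ ps)    ≡⟨ ∣⋃∣-disjoint disjoint ⟨
    ∣ ⋃ ps ∣            ≤⟨ ∣p∣≤n (⋃ ps) ⟩
    v                   ≡⟨ len≡v ⟨
    length ps           ≡⟨ length-map ∣_∣ ps ⟨
    length (map ∣_∣ ps) ∎))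
  where open ≤-Reasoning

-- Block complementation of a design.

Unique-extract : ∀ {a} {X : Set a} {x : X} {xs} → Unique xs → x ∈ₗ xs →
  ∃[ ys ] Unique (x ∷ ys) × xs ↭ x ∷ ys
Unique-extract {X = X} {x} xs! x∈xs with ∈-∃++ x∈xs
... | ys , zs , refl =
  ys ++ zs , Unique-resp-↭ (setoid X) (↭⇒↭ₛ (shift x ys zs)) xs! , shift x ys zs

-- Moving `A` to the front of the listing lets `A △_` act on the other blocks only. Injectivity
-- keeps their images distinct, and `⊥ ∉ 𝓓` keeps them different from `A`.
⋆-cardinality : ∀ {v m} {𝓓 : Design v} {A} → A ∈ 𝓓 → ⊥ ∉ 𝓓 →
  HasCardinality 𝓓 m → HasCardinality (𝓓 ⋆ A) m
⋆-cardinality {v} {m} {𝓓} {A} A∈𝓓 ⊥∉𝓓 (Bs , Bs! , len , Bs⇔𝓓)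
  with Unique-extract Bs! (Equivalence.from (Bs⇔𝓓 A) A∈𝓓)
... | Cs , A≢Cs ∷ Cs! , Bs↭ =
  A ∷ map (A △_) Cs
  , All.map⁺ (All.tabulate A≢A△) ∷ Unique.map⁺ (△-injectiveʳ A) Cs!
  , trans (cong suc (length-map (A △_) Cs)) (trans (sym (↭-length Bs↭)) len)
  , λ C → mk⇔ to from
  where
  Cs⊆𝓓 : ∀ {C} → C ∈ₗ Cs → C ∈ 𝓓
  Cs⊆𝓓 C∈ = Equivalence.to (Bs⇔𝓓 _) (∈-resp-↭ (↭-sym Bs↭) (there C∈))

  A≢A△ : ∀ {C} → C ∈ₗ Cs → A ≢ A △ C
  A≢A△ {C} C∈ eq = ⊥∉𝓓 (subst (_∈ 𝓓) (A△B≡A⇒B≡⊥ A C (sym eq)) (Cs⊆𝓓 C∈))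

  to : ∀ {C} → C ∈ₗ A ∷ map (A △_) Cs → C ∈ (𝓓 ⋆ A)
  to (here C≡A) = inj₁ C≡A
  to (there C∈) with ∈-map⁻ (A △_) C∈
  ... | B , B∈Cs , C≡ = inj₂ (B , Cs⊆𝓓 B∈Cs , ≢-sym (All.lookup A≢Cs B∈Cs) , C≡)

  from : ∀ {C} → C ∈ (𝓓 ⋆ A) → C ∈ₗ A ∷ map (A △_) Cs
  from (inj₁ C≡A) = here C≡A
  from (inj₂ (B , B∈𝓓 , B≢A , refl)) with ∈-resp-↭ Bs↭ (Equivalence.from (Bs⇔𝓓 B) B∈𝓓)
  ... | here B≡A   = contradiction B≡A B≢A
  ... | there B∈Cs = there (∈-map⁺ (A △_) B∈Cs)

⋆-involutive : ∀ {v} {𝓓 : Design v} {A} → A ∈ 𝓓 → ⊥ ∉ 𝓓 → 𝓓 ≐ 𝓓 ⋆ A ⋆ A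
⋆-involutive {v} {𝓓} {A} A∈𝓓 ⊥∉𝓓 = ⊆ , ⊇
  where
  ⊆ : ∀ {B} → B ∈ 𝓓 → B ∈ (𝓓 ⋆ A ⋆ A)
  ⊆ {B} B∈𝓓 with B ≟ˢ A
  ... | yes B≡A = inj₁ B≡A
  ... | no  B≢A = inj₂
    ( A △ B , inj₂ (B , B∈𝓓 , B≢A , refl)
    , (λ eq → ⊥∉𝓓 (subst (_∈ 𝓓) (A△B≡A⇒B≡⊥ A B eq) B∈𝓓))
    , sym (△-involutive A B))

  ⊇ : ∀ {C} → C ∈ (𝓓 ⋆ A ⋆ A) → C ∈ 𝓓
  ⊇ (inj₁ refl)                         = A∈𝓓
  -- Vacuous: the second complementation leaves `A` in place and applies `A △_` only to blocks other
  -- than `A`.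
  ⊇ (inj₂ (_ , inj₁ B≡A , B≢A , _))     = contradiction B≡A B≢A
  ⊇ (inj₂ (_ , inj₂ (B , B∈𝓓 , _ , refl) , _ , refl)) =
    subst (_∈ 𝓓) (sym (△-involutive A B)) B∈𝓓

-- Type-2 is a negation, while `distinctSizes` asks for actual blocks; a search through the finite
-- listing extracts one constructively.
∃-size≢ : ∀ {v m k} {𝓓 : Design v} → HasCardinality 𝓓 m →
  ¬ (∀ {B} → B ∈ 𝓓 → ∣ B ∣ ≡ k) → ∃[ B ] B ∈ 𝓓 × ∣ B ∣ ≢ k
∃-size≢ {k = k} {𝓓} (Bs , _ , _ , Bs⇔𝓓) ¬uniform
  with All.search (λ B → ¬? (∣ B ∣ ≟ k)) Bs
... | inj₁ uniform = contradiction
  -- A failed search for a size other than `k` yields only double negations, removed by decidability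
  -- of equality on numbers.
  (λ {B} B∈𝓓 → decidable-stable (∣ B ∣ ≟ k)
    (All.lookup uniform (Equivalence.from (Bs⇔𝓓 B) B∈𝓓))) ¬uniform
... | inj₂ any with find any
...   | B , B∈Bs , ∣B∣≢k = B , Equivalence.to (Bs⇔𝓓 B) B∈Bs , ∣B∣≢k

-- Comparing a sum with a double.

m<n⇒m+n<2*n : ∀ {m n} → m < n → m + n < 2 * n
m<n⇒m+n<2*n {m} {n} m<n rewrite +-identityʳ n = +-monoˡ-< n m<n

n<m⇒2*n<m+n : ∀ {m n} → n < m → 2 * n < m + n
n<m⇒2*n<m+n {m} {n} n<m rewrite +-identityʳ n = +-monoˡ-< n n<m

2*m<m+n⇒m<n : ∀ m {n} → 2 * m < m + n → m < n
2*m<m+n⇒m<n m {n} lt rewrite +-identityʳ m = +-cancelˡ-< m m n lt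

m+n<2*m⇒n<m : ∀ m {n} → m + n < 2 * m → n < m
m+n<2*m⇒n<m m {n} lt rewrite +-identityʳ m = +-cancelˡ-< m n m lt

2*m∸m≡m : ∀ m → 2 * m ∸ m ≡ m
2*m∸m≡m m = trans (m+n∸m≡n m (m + 0)) (+-identityʳ m)

-- Complementation of a Ryser design.

module _ {v l : ℕ} {𝓓 : Design v} (ryser : IsRyser l 𝓓) where
  open IsRyser ryser

  -- Singletons throughout would contradict `distinctSizes`. Positivity is what makes the new index
  -- strictly smaller than `∣ A ∣`.
  index>0 : 0 < l
  index>0 = n≢0⇒n>0 λ l≡0 →
    let Bs , Bs! , len , Bs⇔𝓓 = cardinality
        B₁ , B₂ , B₁∈𝓓 , B₂∈𝓓 , ∣B₁∣≢∣B₂∣ = distinctSizes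
        in𝓓 = λ {B} → Equivalence.to (Bs⇔𝓓 B)
        inBs = λ {B} → Equivalence.from (Bs⇔𝓓 B)
        singletons = disjoint-nonempty⇒All-singleton len
          (All.tabulate λ B∈Bs → ≤-trans (s≤s z≤n) (blockSize>l (in𝓓 B∈Bs)))
          (AllPairs-map-∈ (λ B∈Bs C∈Bs B≢C →
            trans (intersection (in𝓓 B∈Bs) (in𝓓 C∈Bs) B≢C) l≡0) Bs!)
    in ∣B₁∣≢∣B₂∣ (trans (All.lookup singletons (inBs B₁∈𝓓))
                        (sym (All.lookup singletons (inBs B₂∈𝓓))))

  ⊥∉Ryser : ⊥ ∉ 𝓓
  ⊥∉Ryser ⊥∈𝓓 = n≮0 (subst (l <_) (∣⊥∣≡0 v) (blockSize>l ⊥∈𝓓))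

  l+[∣B∣∸l]≡∣B∣ : ∀ {B} → B ∈ 𝓓 → l + (∣ B ∣ ∸ l) ≡ ∣ B ∣
  l+[∣B∣∸l]≡∣B∣ B∈𝓓 = m+[n∸m]≡n (<⇒≤ (blockSize>l B∈𝓓))

  module _ {A : Subset v} (A∈𝓓 : A ∈ 𝓓) where

    -- The second summand is the new index, so comparing this size with twice the new index amounts
    -- to comparing `∣ B ∣` with `∣ A ∣`.
    ∣A△B∣ : ∀ {B} → B ∈ 𝓓 → B ≢ A → ∣ A △ B ∣ ≡ (∣ B ∣ ∸ l) + (∣ A ∣ ∸ l)
    ∣A△B∣ {B} B∈𝓓 B≢A = +-cancelʳ-≡ (l + l) _ _ (begin
      ∣ A △ B ∣ + (l + l)
        ≡⟨ cong (λ m → ∣ A △ B ∣ + (m + m)) (intersection A∈𝓓 B∈𝓓 (≢-sym B≢A)) ⟨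
      ∣ A △ B ∣ + (∣ A ∩ B ∣ + ∣ A ∩ B ∣)
        ≡⟨ ∣△∣ A B ⟩
      ∣ A ∣ + ∣ B ∣
        ≡⟨ cong₂ _+_ (l+[∣B∣∸l]≡∣B∣ A∈𝓓) (l+[∣B∣∸l]≡∣B∣ B∈𝓓) ⟨
      (l + (∣ A ∣ ∸ l)) + (l + (∣ B ∣ ∸ l))
        ≡⟨ rearrange l (∣ A ∣ ∸ l) (∣ B ∣ ∸ l) ⟩
      (∣ B ∣ ∸ l) + (∣ A ∣ ∸ l) + (l + l) ∎)
      where
      open ≡-Reasoning
      rearrange : ∀ m a b → (m + a) + (m + b) ≡ b + a + (m + m)
      rearrange = solve-∀

    ⋆-intersection : ∀ {B₁ B₂} → B₁ ∈ (𝓓 ⋆ A) → B₂ ∈ (𝓓 ⋆ A) → B₁ ≢ B₂ →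
      ∣ B₁ ∩ B₂ ∣ ≡ ∣ A ∣ ∸ l
    ⋆-intersection (inj₁ refl) (inj₁ refl) A≢A = contradiction refl A≢A
    ⋆-intersection (inj₁ refl) (inj₂ (B , B∈𝓓 , B≢A , refl)) _ = begin
      ∣ A ∩ (A △ B) ∣                         ≡⟨ m+n∸n≡m _ ∣ A ∩ B ∣ ⟨
      ∣ A ∩ (A △ B) ∣ + ∣ A ∩ B ∣ ∸ ∣ A ∩ B ∣ ≡⟨ cong₂ _∸_ (∣A∩[A△B]∣+∣A∩B∣≡∣A∣ A B)
                                                   (intersection A∈𝓓 B∈𝓓 (≢-sym B≢A)) ⟩
      ∣ A ∣ ∸ l                               ∎
      where open ≡-Reasoning
    -- Reduced to the preceding case by commutativity of `∩`.
    ⋆-intersection B₁∈@(inj₂ (B , _ , _ , refl)) A∈@(inj₁ refl) B₁≢A =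
      trans (cong ∣_∣ (∩-comm (A △ B) A)) (⋆-intersection A∈ B₁∈ (≢-sym B₁≢A))
    ⋆-intersection (inj₂ (B , B∈𝓓 , B≢A , refl)) (inj₂ (C , C∈𝓓 , C≢A , refl)) A△B≢A△C =
      +-cancelʳ-≡ (l + l) _ _ (begin
        ∣ (A △ B) ∩ (A △ C) ∣ + (l + l)
          ≡⟨ cong (∣ (A △ B) ∩ (A △ C) ∣ +_)
               (cong₂ _+_ (intersection A∈𝓓 B∈𝓓 (≢-sym B≢A)) (intersection A∈𝓓 C∈𝓓 (≢-sym C≢A))) ⟨
        ∣ (A △ B) ∩ (A △ C) ∣ + (∣ A ∩ B ∣ + ∣ A ∩ C ∣)
          ≡⟨ ∣△∩△∣ A B C ⟩
        ∣ A ∣ + ∣ B ∩ C ∣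
          -- `B` and `C` differ because their images under `A △_` do.
          ≡⟨ cong (∣ A ∣ +_) (intersection B∈𝓓 C∈𝓓 (A△B≢A△C ∘ cong (A △_))) ⟩
        ∣ A ∣ + l
          ≡⟨ cong (_+ l) (m∸n+n≡m (<⇒≤ (blockSize>l A∈𝓓))) ⟨
        ∣ A ∣ ∸ l + l + l
          ≡⟨ +-assoc (∣ A ∣ ∸ l) l l ⟩
        ∣ A ∣ ∸ l + (l + l) ∎)
      where open ≡-Reasoning

    ∣A∣>∣A∣∸l : ∣ A ∣ > ∣ A ∣ ∸ l
    ∣A∣>∣A∣∸l = ∸-monoʳ-< index>0 (<⇒≤ (blockSize>l A∈𝓓))

    ⋆-blockSize> : ∀ {B} → B ∈ (𝓓 ⋆ A) → ∣ B ∣ > ∣ A ∣ ∸ l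
    ⋆-blockSize> (inj₁ refl) = ∣A∣>∣A∣∸l
    ⋆-blockSize> (inj₂ (B , B∈𝓓 , B≢A , refl)) =
      subst (∣ A ∣ ∸ l <_) (sym (∣A△B∣ B∈𝓓 B≢A))
        -- The strict bound unfolds to `1 + (∣ A ∣ ∸ l) ≤ _`, and the 1 is covered by
        -- `1 ≤ ∣ B ∣ ∸ l`.
        (+-monoˡ-≤ (∣ A ∣ ∸ l) (m<n⇒0<n∸m (blockSize>l B∈𝓓)))

    ⋆-uniform⇒Type-1 : ¬ Average l A → (∀ {B} → B ∈ (𝓓 ⋆ A) → ∣ B ∣ ≡ ∣ A ∣) → Type-1 𝓓
    ⋆-uniform⇒Type-1 ∣A∣≢2l uniform =
      -- The symmetric design is `𝓓 ⋆ A` itself with `k = ∣ A ∣`; then `k ≢ 2 * l` says that `A` is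
      -- not average, and complementing again recovers `𝓓`.
      ∣ A ∣ , l , 𝓓 ⋆ A , A , symmetric , ∣A∣≢2l , inj₁ refl , ⋆-involutive A∈𝓓 ⊥∉Ryser
      where
      symmetric : IsSymmetric ∣ A ∣ (∣ A ∣ ∸ l) (𝓓 ⋆ A)
      symmetric = record
        { cardinality  = ⋆-cardinality A∈𝓓 ⊥∉Ryser cardinality
        ; intersection = ⋆-intersection
        ; l≥1          = m<n⇒0<n∸m (blockSize>l A∈𝓓)
        ; blockSize    = uniform
        ; k>l          = ∣A∣>∣A∣∸l
        }

    ⋆-isRyser : Type-2 𝓓 → ¬ Average l A → IsRyser (∣ A ∣ ∸ l) (𝓓 ⋆ A)
    ⋆-isRyser type-2 ∣A∣≢2l = record
      { cardinality   = card
      ; intersection  = ⋆-intersection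
      ; blockSize>l   = ⋆-blockSize>
      ; distinctSizes =
          -- `A` survives as a block of `𝓓 ⋆ A`, so it suffices to find one block of a different
          -- size; otherwise `𝓓` would be of Type-1.
          let B , B∈ , ∣B∣≢∣A∣ = ∃-size≢ card (type-2 ∘ ⋆-uniform⇒Type-1 ∣A∣≢2l)
          in B , A , B∈ , inj₁ refl , ∣B∣≢∣A∣
      }
      where card = ⋆-cardinality A∈𝓓 ⊥∉Ryser cardinality

    -- With l′ = `∣ A ∣ ∸ l`, the size of `A` is l + l′, symmetric in the two indices: both 2l < l +
    -- l′ and l + l′ < 2l′ mean l < l′. The converse comparison exchanges the roles.
    Large⇒⋆-Small : Large l A → Small (∣ A ∣ ∸ l) A
    Large⇒⋆-Small large = subst (_< 2 * (∣ A ∣ ∸ l)) (l+[∣B∣∸l]≡∣B∣ A∈𝓓)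
      (m<n⇒m+n<2*n (2*m<m+n⇒m<n l (subst (2 * l <_) (sym (l+[∣B∣∸l]≡∣B∣ A∈𝓓)) large)))

    Small⇒⋆-Large : Small l A → Large (∣ A ∣ ∸ l) A
    Small⇒⋆-Large small = subst (2 * (∣ A ∣ ∸ l) <_) (l+[∣B∣∸l]≡∣B∣ A∈𝓓)
      (n<m⇒2*n<m+n (m+n<2*m⇒n<m l (subst (_< 2 * l) (sym (l+[∣B∣∸l]≡∣B∣ A∈𝓓)) small)))

    module _ {B : Subset v} (B∈𝓓 : B ∈ 𝓓) (B≢A : B ≢ A) where

      ∣B∣>∣A∣⇒Large : ∣ B ∣ > ∣ A ∣ → Large (∣ A ∣ ∸ l) (A △ B)
      ∣B∣>∣A∣⇒Large ∣B∣>∣A∣ = subst (2 * (∣ A ∣ ∸ l) <_) (sym (∣A△B∣ B∈𝓓 B≢A))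
        (n<m⇒2*n<m+n (∸-monoˡ-< ∣B∣>∣A∣ (<⇒≤ (blockSize>l A∈𝓓))))

      ∣B∣<∣A∣⇒Small : ∣ B ∣ < ∣ A ∣ → Small (∣ A ∣ ∸ l) (A △ B)
      ∣B∣<∣A∣⇒Small ∣B∣<∣A∣ = subst (_< 2 * (∣ A ∣ ∸ l)) (sym (∣A△B∣ B∈𝓓 B≢A))
        -- Truncated subtraction of `l` stays strictly monotone here because the smaller size
        -- `∣ B ∣` is at least `l`.
        (m<n⇒m+n<2*n (∸-monoˡ-< ∣B∣<∣A∣ (<⇒≤ (blockSize>l B∈𝓓))))

      -- An average block exceeds the index by exactly `l`, which restores the `l` removed from
      -- `∣ A ∣`.
      ∣B∣≡2l⇒∣A△B∣≡∣A∣ : ∣ B ∣ ≡ 2 * l → ∣ A △ B ∣ ≡ ∣ A ∣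
      ∣B∣≡2l⇒∣A△B∣≡∣A∣ ∣B∣≡2l = begin
        ∣ A △ B ∣                   ≡⟨ ∣A△B∣ B∈𝓓 B≢A ⟩
        (∣ B ∣ ∸ l) + (∣ A ∣ ∸ l)   ≡⟨ cong (λ m → m ∸ l + (∣ A ∣ ∸ l)) ∣B∣≡2l ⟩
        (2 * l ∸ l) + (∣ A ∣ ∸ l)   ≡⟨ cong (_+ (∣ A ∣ ∸ l)) (2*m∸m≡m l) ⟩
        l + (∣ A ∣ ∸ l)             ≡⟨ l+[∣B∣∸l]≡∣B∣ A∈𝓓 ⟩
        ∣ A ∣                       ∎
        where open ≡-Reasoning

      ∣B∣≡∣A∣⇒∣A△B∣≡2l′ : ∣ B ∣ ≡ ∣ A ∣ → ∣ A △ B ∣ ≡ 2 * (∣ A ∣ ∸ l)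
      ∣B∣≡∣A∣⇒∣A△B∣≡2l′ ∣B∣≡∣A∣ = begin
        ∣ A △ B ∣                         ≡⟨ ∣A△B∣ B∈𝓓 B≢A ⟩
        (∣ B ∣ ∸ l) + (∣ A ∣ ∸ l)         ≡⟨ cong (λ m → m ∸ l + (∣ A ∣ ∸ l)) ∣B∣≡∣A∣ ⟩
        (∣ A ∣ ∸ l) + (∣ A ∣ ∸ l)         ≡⟨ cong ((∣ A ∣ ∸ l) +_) (+-identityʳ (∣ A ∣ ∸ l)) ⟨
        2 * (∣ A ∣ ∸ l)                   ∎
        where open ≡-Reasoning

theorem3p1 :
  ∀ (v l : ℕ) (𝓓 : Design v) → IsRyser l 𝓓 → Type-2 𝓓 →
  ∀ (A : Subset v) → A ∈ 𝓓 → ¬ Average l A →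
  let l′ = ∣ A ∣ ∸ l
      𝓓′ = 𝓓 ⋆ A
  in
  IsRyser l′ 𝓓′ ×
  A ∈ 𝓓′ ×
  (Large l A → Small l′ A) ×
  (Small l A → Large l′ A) ×
  (∀ (B : Subset v) → B ∈ 𝓓 → B ≢ A →
    (A △ B) ∈ 𝓓′ ×
    (∣ B ∣ > ∣ A ∣ → Large l′ (A △ B)) ×
    (∣ B ∣ < ∣ A ∣ → Small l′ (A △ B)) ×
    (∣ B ∣ ≡ 2 * l → ∣ A △ B ∣ ≡ ∣ A ∣) ×
    (∣ B ∣ ≡ ∣ A ∣ → ∣ A △ B ∣ ≡ 2 * l′))
theorem3p1 v l 𝓓 ryser type-2 A A∈𝓓 ∣A∣≢2l =
  ⋆-isRyser ryser A∈𝓓 type-2 ∣A∣≢2l ,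
  inj₁ refl ,
  Large⇒⋆-Small ryser A∈𝓓 ,
  Small⇒⋆-Large ryser A∈𝓓 ,
  λ B B∈𝓓 B≢A →
    inj₂ (B , B∈𝓓 , B≢A , refl) ,
    ∣B∣>∣A∣⇒Large ryser A∈𝓓 B∈𝓓 B≢A ,
    ∣B∣<∣A∣⇒Small ryser A∈𝓓 B∈𝓓 B≢A ,
    ∣B∣≡2l⇒∣A△B∣≡∣A∣ ryser A∈𝓓 B∈𝓓 B≢A ,
    ∣B∣≡∣A∣⇒∣A△B∣≡2l′ ryser A∈𝓓 B∈𝓓 B≢A
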